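{- Let $\Gamma$ be a finite tree that has a perfect matching. Then $\Gamma$ is $1$-lit.
   Context: Let $\Gamma=(S,R)$ be a finite simple graph. A configuration of the lit-only $\sigma$-game on $\Gamma$ is an assignment of one of two states, on or off, to every vertex of $\Gamma$. Given a configuration, a move consists of choosing a vertex $s$ whose state is on and changing the states of all neighbors of $s$ (on becomes off and off becomes on). For an integer $k$, $\Gamma$ is called $k$-lit if, for every configuration, the number of on vertices can be reduced to at most $k$ by a finite sequence of moves. -}

module Defs where

open import Data.Nat using (ℕ; zero; suc; _+_; _≤_; _<_)
open import Data.Fin using (Fin; toℕ)
open import Data.Fin.Properties using (_≟_)
open import Data.Bool using (Bool; true; false; not; if_then_else_; _xor_)
open import Data.List using (List; []; _∷_; map)
open import Data.Nat.ListAction using (sum)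
open import Data.List.Base using (allFin)
open import Data.Product using (Σ; _×_; _,_; ∃)
open import Relation.Binary.PropositionalEquality using (_≡_)
open import Relation.Nullary using (¬_; does)
open import Relation.Binary.Construct.Closure.ReflexiveTransitive using (Star)

record Graph (n : ℕ) : Set where
  field
    adj   : Fin n → Fin n → Bool
    sym   : ∀ u v → adj u v ≡ adj v u
    irrefl : ∀ v → adj v v ≡ false
open Graph public

data Walk {n : ℕ} (Γ : Graph n) : Fin n → Fin n → Set where
  here : ∀ {v} → Walk Γ v v
  step : ∀ {u w v} → adj Γ u w ≡ true → Walk Γ w v → Walk Γ u v

Connected : ∀ {n} → Graph n → Set
Connected Γ = ∀ u v → Walk Γ u v

countTrue : List Bool → ℕ
countTrue [] = 0
countTrue (true ∷ bs) = suc (countTrue bs)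
countTrue (false ∷ bs) = countTrue bs

ltB : ∀ {n} → Fin n → Fin n → Bool
ltB u v = does (suc (toℕ u) Data.Nat.≤? toℕ v)

edgeCount : ∀ {n} → Graph n → ℕ
edgeCount {n} Γ =
  sum (map (λ u → countTrue (map (λ v → if ltB u v then adj Γ u v else false) (allFin n))) (allFin n))

IsTree : ∀ {n} → Graph n → Set
IsTree {zero} Γ = Data.Empty.⊥ where import Data.Empty
IsTree {suc m} Γ = Connected Γ × edgeCount Γ ≡ m

record PerfectMatching {n : ℕ} (Γ : Graph n) : Set where
  field
    partner    : Fin n → Fin n
    partner-adj : ∀ v → adj Γ v (partner v) ≡ true
    partner-inv : ∀ v → partner (partner v) ≡ v

Config : ℕ → Set
Config n = Fin n → Bool

toggleNbrs : ∀ {n} → Graph n → Fin n → Config n → Config n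
toggleNbrs Γ s c v = c v xor adj Γ s v

data Move {n : ℕ} (Γ : Graph n) : Config n → Config n → Set where
  move : ∀ (s : Fin n) {c} → c s ≡ true → Move Γ c (toggleNbrs Γ s c)

Reachable : ∀ {n} → Graph n → Config n → Config n → Set
Reachable Γ = Star (Move Γ)

numOn : ∀ {n} → Config n → ℕ
numOn {n} c = countTrue (map c (allFin n))

KLit : ∀ {n} → ℕ → Graph n → Set
KLit {n} k Γ = ∀ (c : Config n) → Σ (Config n) λ c' → Reachable Γ c c' × numOn c' ≤ k

{-# OPTIONS --safe #-}

-- If some vertex has two neighbours besides its partner, the tree contains E₆ and
-- is built from it by attaching matched pairs u′ – u along an edge u – w.
-- The adjacency matrix is invertible over 𝔽₂, so configurations carry the
-- quadratic form Q(x) = #vertices + #edges of the support of x, which every move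
-- preserves.  Attaching pairs to E₆, one sees inductively that two configurations
-- with some vertex on are equivalent as soon as Q agrees.  The configurations with
-- only u′, respectively only w, on have different values of Q, so every orbit
-- contains one with at most one vertex on.
-- Otherwise the tree is a path; there, configurations are the difference sequences
-- of binary words, moves swap adjacent letters, and a sorted word has at most one
-- difference.

module Submission where

open import Algebra.Properties.CommutativeSemigroup using (interchange)
open import Data.Bool using (Bool; true; false; not; _∧_; _xor_; if_then_else_)
open import Data.Bool.Properties using (¬-not; xor-same; xor-identityʳ; xor-assoc; xor-comm; ∧-zeroʳ) renaming (_≟_ to _≟ᵇ_)
open import Data.Bool.Solver using (module xor-∧-Solver)
open import Data.Fin using (Fin; zero; suc)
open import Data.Fin.Properties using (_≟_; any?; injective⇒≤)
open import Data.List as List using (List; []; _∷_; _++_; [_]; map; length; allFin) renaming (lookup to infix 9 _‼_)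
open import Data.List.Membership.Propositional using (_∈_; _∉_)
open import Data.List.Membership.Propositional.Properties using (∈-allFin; ∈-lookup)
open import Data.List.Membership.Propositional.Properties.WithK using (unique∧set⇒bag)
open import Data.List.Properties using (map-cong; map-tabulate; map-∘; length-tabulate; ++-assoc)
open import Data.List.Relation.Binary.BagAndSetEquality using (∼bag⇒↭)
open import Data.List.Relation.Binary.Permutation.Propositional as Perm using (_↭_; prep; swap; ↭-refl; ↭-sym; ↭-trans; ↭-reflexive; ↭⇒↭ₛ)
open import Data.List.Relation.Binary.Permutation.Propositional.Properties using (↭-length; ∈-resp-↭; ++-comm) renaming (map⁺ to ↭-map⁺)
open import Data.List.Relation.Binary.Permutation.Setoid.Properties using (Unique-resp-↭)
open import Data.List.Relation.Unary.All as All using (All; []; _∷_)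
open import Data.List.Relation.Unary.All.Properties using (¬Any⇒All¬)
open import Data.List.Relation.Unary.AllPairs using ([]; _∷_)
open import Data.List.Relation.Unary.Any using (here; there; index)
open import Data.List.Relation.Unary.Any.Properties using (lookup-index)
open import Data.List.Relation.Unary.Linked using (Linked; []; [-]; _∷_)
open import Data.List.Relation.Unary.Unique.Propositional using (Unique)
open import Data.List.Relation.Unary.Unique.Propositional.Properties using (allFin⁺)
open import Data.Nat using (ℕ; zero; suc; _+_; _≤_; _<_; z≤n; s≤s; s≤s⁻¹)
open import Data.Nat.ListAction using (sum)
open import Data.Nat.Properties using (≤-refl; ≤-reflexive; ≤-trans; <-irrefl; <-≤-trans; ≤-<-trans; <⇒≱; m≤n+m; +-monoˡ-≤; +-identityʳ; +-suc; +-commutativeSemigroup)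
open import Data.Product using (∃; ∃₂; _×_; _,_; proj₁)
open import Data.Sum using (_⊎_; inj₁; inj₂)
open import Data.Unit using (⊤; tt)
open import Data.Vec as Vec using (Vec; []; _∷_; head; lookup; replicate; zipWith; toList; fromList)
open import Data.Vec.Properties using (∷-injective; lookup-zipWith; lookup-replicate; zipWith-comm; zipWith-identityˡ; tabulate∘lookup; tabulate-cong)
open import Function using (_∘_; mk⇔)
open import Relation.Binary.Construct.Closure.ReflexiveTransitive using (Star; ε; _◅_; _◅◅_; reverse)
open import Relation.Binary.PropositionalEquality using (_≡_; _≢_; refl; trans; cong; cong₂; subst; setoid; module ≡-Reasoning) renaming (sym to ≡-sym)
open import Relation.Nullary using (¬_; yes; no; contradiction; ¬?)
open import Relation.Nullary.Decidable using (decidable-stable; _×-dec_)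
open import Defs

-- The game in coordinates

zeros : ∀ {n} → Vec Bool n
zeros = replicate _ false

single : ∀ {n} → Fin n → Vec Bool n
single zero    = true ∷ zeros
single (suc i) = false ∷ single i

infixr 6 _⊕_
_⊕_ : ∀ {n} → Vec Bool n → Vec Bool n → Vec Bool n
_⊕_ = zipWith _xor_

⊕-identityˡ : ∀ {n} (f : Vec Bool n) → zeros ⊕ f ≡ f
⊕-identityˡ = zipWith-identityˡ (λ _ → refl)

⊕-comm : ∀ {n} (f g : Vec Bool n) → f ⊕ g ≡ g ⊕ f
⊕-comm = zipWith-comm xor-comm

⊕-identityʳ : ∀ {n} (f : Vec Bool n) → f ⊕ zeros ≡ f
⊕-identityʳ f = trans (⊕-comm f zeros) (⊕-identityˡ f)

⊕-cancelˡ : ∀ {n} (f g : Vec Bool n) → f ⊕ f ⊕ g ≡ g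
⊕-cancelˡ []      []      = refl
⊕-cancelˡ (a ∷ f) (b ∷ g) =
  cong₂ _∷_ (trans (≡-sym (xor-assoc a a b)) (cong (_xor b) (xor-same a))) (⊕-cancelˡ f g)

lookup-single : ∀ {n} (i : Fin n) → lookup (single i) i ≡ true
lookup-single zero    = refl
lookup-single (suc i) = lookup-single i

lookup-single-≢ : ∀ {n} {i j : Fin n} → j ≢ i → lookup (single i) j ≡ false
lookup-single-≢ {i = zero}  {zero}  j≢i = contradiction refl j≢i
lookup-single-≢ {i = zero}  {suc j} _   = lookup-replicate j false
lookup-single-≢ {i = suc i} {zero}  _   = refl
lookup-single-≢ {i = suc i} {suc j} j≢i = lookup-single-≢ (λ eq → j≢i (cong suc eq))

lookup-ext : ∀ {n} {f g : Vec Bool n} → (∀ i → lookup f i ≡ lookup g i) → f ≡ g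
lookup-ext {f = f} {g} eq =
  trans (≡-sym (tabulate∘lookup f)) (trans (tabulate-cong eq) (tabulate∘lookup g))

countTrue-zeros : ∀ n → countTrue (toList (zeros {n})) ≡ 0
countTrue-zeros zero    = refl
countTrue-zeros (suc n) = countTrue-zeros n

countTrue-single : ∀ {n} (i : Fin n) → countTrue (toList (single i)) ≡ 1
countTrue-single {suc n} zero = cong suc (countTrue-zeros n)
countTrue-single (suc i)      = countTrue-single i

-- A configuration of `ext T g` is written u′ ∷ u ∷ f, where f lives on T, the
-- new vertex u is joined to u′ and to the vertices of T lying in g.
data Shape : ℕ → Set where
  nil : Shape 0
  ext : ∀ {n} → Shape n → Vec Bool n → Shape (2 + n)

nbr : ∀ {n} → Shape n → Fin n → Vec Bool n
nbr (ext T g) zero          = false ∷ true ∷ zeros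
nbr (ext T g) (suc zero)    = true ∷ false ∷ g
nbr (ext T g) (suc (suc s)) = false ∷ lookup g s ∷ nbr T s

-- β and Q transport to configurations, along f = A x, the form xᵀ A y given by
-- the adjacency matrix A and the form counting vertices plus edges of the
-- support of x.
β : ∀ {n} → Shape n → Vec Bool n → Vec Bool n → Bool
β nil       _            _            = false
β (ext T g) (b ∷ a ∷ f) (b′ ∷ a′ ∷ f′) =
  β T f f′ xor (b ∧ (a′ xor β T f′ g)) xor (b′ ∧ (a xor β T f g))

Q : ∀ {n} → Shape n → Vec Bool n → Bool
Q nil       _           = false
Q (ext T g) (b ∷ a ∷ f) =
  Q T f xor (b ∧ not (Q T g)) xor (a xor β T f g) xor (b ∧ (a xor β T f g))

-- Identities for the bilinear and the quadratic form

open xor-∧-Solver using (solve; _:+_; _:*_; _:=_; con)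

β-⊕ˡ : ∀ {n} (T : Shape n) f f′ h → β T (f ⊕ f′) h ≡ β T f h xor β T f′ h
β-⊕ˡ nil       _           _              _           = refl
β-⊕ˡ (ext T g) (b ∷ a ∷ f) (b′ ∷ a′ ∷ f′) (d ∷ c ∷ h)
  rewrite β-⊕ˡ T f f′ h | β-⊕ˡ T f f′ g =
  solve 11 (λ b a b′ a′ d c x x′ y y′ z →
     (x :+ x′) :+ ((b :+ b′) :* (c :+ z) :+ d :* ((a :+ a′) :+ (y :+ y′)))
     := (x :+ (b :* (c :+ z) :+ d :* (a :+ y))) :+ (x′ :+ (b′ :* (c :+ z) :+ d :* (a′ :+ y′))))
    refl b a b′ a′ d c (β T f h) (β T f′ h) (β T f g) (β T f′ g) (β T h g)

β-sym : ∀ {n} (T : Shape n) f h → β T f h ≡ β T h f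
β-sym nil       _           _           = refl
β-sym (ext T g) (b ∷ a ∷ f) (d ∷ c ∷ h) rewrite β-sym T f h =
  cong (β T h f xor_) (xor-comm (b ∧ (c xor β T h g)) (d ∧ (a xor β T f g)))

β-alt : ∀ {n} (T : Shape n) f → β T f f ≡ false
β-alt nil       _           = refl
β-alt (ext T g) (b ∷ a ∷ f) rewrite β-alt T f = xor-same (b ∧ (a xor β T f g))

β-zeroˡ : ∀ {n} (T : Shape n) h → β T zeros h ≡ false
β-zeroˡ nil       _           = refl
β-zeroˡ (ext T g) (d ∷ c ∷ h) rewrite β-zeroˡ T h | β-zeroˡ T g = ∧-zeroʳ d

β-zeroʳ : ∀ {n} (T : Shape n) f → β T f zeros ≡ false
β-zeroʳ T f = trans (β-sym T f zeros) (β-zeroˡ T f)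

Q-zero : ∀ {n} (T : Shape n) → Q T zeros ≡ false
Q-zero nil       = refl
Q-zero (ext T g) rewrite Q-zero T | β-zeroˡ T g = refl

-- `β` is the polar form of `Q`, which reduces the effect of a move on `Q` to a value of `β`.
Q-⊕ : ∀ {n} (T : Shape n) f f′ → Q T (f ⊕ f′) ≡ Q T f xor Q T f′ xor β T f f′
Q-⊕ nil       _           _              = refl
Q-⊕ (ext T g) (b ∷ a ∷ f) (b′ ∷ a′ ∷ f′)
  rewrite Q-⊕ T f f′ | β-⊕ˡ T f f′ g =
  solve 10 (λ b a b′ a′ x x′ w y y′ r →
     let q = a :+ y ; q′ = a′ :+ y′ in
     (x :+ (x′ :+ w)) :+ ((b :+ b′) :* (con true :+ r)
       :+ (((a :+ a′) :+ (y :+ y′)) :+ (b :+ b′) :* ((a :+ a′) :+ (y :+ y′))))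
     := (x :+ (b :* (con true :+ r) :+ (q :+ b :* q)))
       :+ ((x′ :+ (b′ :* (con true :+ r) :+ (q′ :+ b′ :* q′))) :+ (w :+ (b :* q′ :+ b′ :* q))))
    refl b a b′ a′ (Q T f) (Q T f′) (β T f f′) (β T f g) (β T f′ g) (Q T g)

-- `nbr T s` is A applied to the unit vector e at s. With f = A x the pairing is xᵀ A e, which by
-- symmetry of A is the entry of f at s.
β-nbr : ∀ {n} (T : Shape n) f s → β T f (nbr T s) ≡ lookup f s
β-nbr (ext T g) (b ∷ a ∷ f) zero
  rewrite β-zeroʳ T f | β-zeroˡ T g =
  solve 1 (λ b → b :* con true :+ con false := b) refl b
β-nbr (ext T g) (b ∷ a ∷ f) (suc zero) rewrite β-alt T g =
  solve 3 (λ b a x → x :+ (b :* con false :+ (a :+ x)) := a) refl b a (β T f g)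
β-nbr (ext T g) (b ∷ a ∷ f) (suc (suc s))
  rewrite β-nbr T f s | β-sym T (nbr T s) g | β-nbr T g s =
  solve 3 (λ b x y → x :+ (b :* (y :+ y) :+ con false) := x) refl b (lookup f s) (lookup g s)

-- The support behind `nbr T s` is s alone: one vertex and no edge.
Q-nbr : ∀ {n} (T : Shape n) s → Q T (nbr T s) ≡ true
Q-nbr (ext T g) zero rewrite Q-zero T | β-zeroˡ T g = refl
Q-nbr (ext T g) (suc zero) rewrite β-alt T g =
  solve 1 (λ x → x :+ ((con true :+ x) :+ con false) := con true) refl (Q T g)
Q-nbr (ext T g) (suc (suc s)) rewrite Q-nbr T s | β-sym T (nbr T s) g | β-nbr T g s =
  cong (λ x → true xor x xor false) (xor-same (lookup g s))

nbr-irrefl : ∀ {n} (T : Shape n) s → lookup (nbr T s) s ≡ false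
nbr-irrefl T s = trans (≡-sym (β-nbr T (nbr T s) s)) (β-alt T (nbr T s))

-- Moves and their invariant

data Play {n} (T : Shape n) : Vec Bool n → Vec Bool n → Set where
  play : ∀ s {f} → lookup f s ≡ true → Play T f (nbr T s ⊕ f)

infix 4 _⊢_~_
_⊢_~_ : ∀ {n} → Shape n → Vec Bool n → Vec Bool n → Set
T ⊢ f ~ g = Star (Play T) f g

-- No vertex is its own neighbour, so s is still on after the move, and playing it again undoes the
-- move.
play-sym : ∀ {n} {T : Shape n} {f g} → Play T f g → Play T g f
play-sym {T = T} (play s {f} fs) =
  subst (Play T (nbr T s ⊕ f)) (⊕-cancelˡ (nbr T s) f)
    (play s (trans (lookup-zipWith _xor_ s (nbr T s) f) (cong₂ _xor_ (nbr-irrefl T s) fs)))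

~-sym : ∀ {n} {T : Shape n} {f g} → T ⊢ f ~ g → T ⊢ g ~ f
~-sym = reverse play-sym

Q-invariant : ∀ {n} {T : Shape n} {f g} → T ⊢ f ~ g → Q T f ≡ Q T g
Q-invariant ε = refl
Q-invariant {T = T} (play s {f} fs ◅ r) = trans (≡-sym eq) (Q-invariant r)
  where
  -- By polarisation `Q` changes by `Q T (nbr T s)` plus the state of s, that is by 1 + 1.
  eq : Q T (nbr T s ⊕ f) ≡ Q T f
  eq rewrite Q-⊕ T (nbr T s) f | β-sym T (nbr T s) f | β-nbr T f s | Q-nbr T s | fs =
    solve 1 (λ x → con true :+ (x :+ con true) := x) refl (Q T f)

record Lit {n} (f : Vec Bool n) : Set where
  constructor on
  field
    vertex : Fin n
    is-on  : lookup f vertex ≡ true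

lit-or-zero : ∀ {n} (f : Vec Bool n) → Lit f ⊎ f ≡ zeros
lit-or-zero []          = inj₂ refl
lit-or-zero (true ∷ f)  = inj₁ (on zero refl)
lit-or-zero (false ∷ f) with lit-or-zero f
... | inj₁ (on t ft) = inj₁ (on (suc t) ft)
... | inj₂ refl     = inj₂ refl

module _ {n : ℕ} {T : Shape n} {g : Vec Bool n} where

  play-u′ : ∀ {a f} → ext T g ⊢ true ∷ a ∷ f ~ true ∷ not a ∷ f
  play-u′ {a} {f} =
    subst (λ h → ext T g ⊢ true ∷ a ∷ f ~ true ∷ not a ∷ h) (⊕-identityˡ f) (play zero refl ◅ ε)

  play-u : ∀ {b f} → ext T g ⊢ b ∷ true ∷ f ~ not b ∷ true ∷ g ⊕ f
  play-u = play (suc zero) refl ◅ ε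

  adjust-u : ∀ a a′ {f} → ext T g ⊢ true ∷ a ∷ f ~ true ∷ a′ ∷ f
  adjust-u true  true  = ε
  adjust-u true  false = play-u′
  adjust-u false true  = play-u′
  adjust-u false false = ε

  -- A move at a vertex lying in g also toggles u, so the final state of u is not controlled; u′ is
  -- adjacent to u only and keeps its state.
  lift : ∀ {f f′} → T ⊢ f ~ f′ → ∀ b a → ∃ λ a′ → ext T g ⊢ b ∷ a ∷ f ~ b ∷ a′ ∷ f′
  lift ε              b a = a , ε
  lift (play s fs ◅ r) b a with lift r b (lookup g s xor a)
  ... | a′ , r′ = a′ , play (suc (suc s)) fs ◅ r′

  -- While u′ is on, playing it toggles u alone, so u can be corrected at the end.
  lift-true : ∀ {f f′} → T ⊢ f ~ f′ → ∀ a a′ → ext T g ⊢ true ∷ a ∷ f ~ true ∷ a′ ∷ f′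
  lift-true r a a′ with lift r true a
  ... | a″ , r′ = r′ ◅◅ adjust-u a″ a′

-- Attaching a matched pair

Illuminable : ∀ {n} → Shape n → Set
Illuminable T = ∀ {f} → Lit f → ∀ w → ∃ λ f′ → T ⊢ f ~ f′ × lookup f′ w ≡ true

Transitive : ∀ {n} → Shape n → Set
Transitive T = ∀ {f g} → Lit f → Lit g → Q T f ≡ Q T g → T ⊢ f ~ g

-- The one link that transitivity of T cannot supply: in T the zero configuration is an orbit of its
-- own, although `Q` does not separate it from a nonzero singular f.
Merging : ∀ {n} → Shape n → Vec Bool n → Set
Merging T g = ∀ {f} → Lit f → Q T f ≡ false →
              ext T g ⊢ true ∷ false ∷ zeros ~ true ∷ false ∷ f

module _ {n : ℕ} {T : Shape n} {g : Vec Bool n}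
         -- An implication rather than `Lit g`, so that the empty shape with its empty g is covered.
         (illuminate : Illuminable T) (attached : ∀ {f : Vec Bool n} → Lit f → Lit g) where

  -- If both new vertices are off, light is led within T to a vertex s of g. Either this has turned
  -- u on along the way, or playing s does; then playing u turns u′ on.
  canonical : ∀ {f} → Lit f → ∃ λ f′ → ext T g ⊢ f ~ true ∷ false ∷ f′
  canonical {true ∷ a ∷ f}      _ = f , adjust-u a false
  canonical {false ∷ true ∷ f}  _ = g ⊕ f , play-u ◅◅ adjust-u true false
  canonical {false ∷ false ∷ f} (on (suc (suc t)) ft) with attached {f} (on t ft)
  ... | on s gs with illuminate {f} (on t ft) s
  ... | f₁ , r , f₁s with lift {g = g} r false false
  ... | true  , r′ = g ⊕ f₁ , r′ ◅◅ play-u ◅◅ adjust-u true false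
  ... | false , r′ = g ⊕ nbr T s ⊕ f₁ , r′ ◅◅ play (suc (suc s)) f₁s ◅
    subst (λ a → ext T g ⊢ false ∷ (a xor false) ∷ nbr T s ⊕ f₁ ~ true ∷ false ∷ g ⊕ nbr T s ⊕ f₁)
      (≡-sym gs)
      (play-u ◅◅ adjust-u true false)

  illuminable-ext : Illuminable (ext T g)
  illuminable-ext lit w with canonical lit
  illuminable-ext lit zero          | f , r = _ , r , refl
  illuminable-ext lit (suc zero)    | f , r = _ , r ◅◅ adjust-u false true , refl
  illuminable-ext lit (suc (suc w)) | f , r with lit-or-zero f
  ... | inj₁ lit′ with illuminate lit′ w
  ... | f′ , r′ , f′w = _ , r ◅◅ lift-true r′ false false , f′w
  -- T is dark here. Playing u from (1, 1, 0) writes g onto T, and g is nonzero because T has the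
  -- vertex w.
  illuminable-ext lit (suc (suc w)) | f , r | inj₂ refl
    with illuminate (attached {single w} (on w (lookup-single w))) w
  ... | f′ , r′ , f′w with lift {g = g} r′ false true
  ... | a , r″ = _ , r ◅◅ adjust-u false true ◅◅ play-u ◅◅
    subst (λ h → ext T g ⊢ false ∷ true ∷ h ~ false ∷ a ∷ f′) (≡-sym (⊕-identityʳ g)) r″ , f′w

  Q-canonical : ∀ f → Q (ext T g) (true ∷ false ∷ f) ≡ Q T f xor not (Q T g)
  Q-canonical f =
    solve 3 (λ x y z → x :+ ((con true :+ y) :+ (z :+ z)) := x :+ (con true :+ y)) refl
      (Q T f) (Q T g) (β T f g)

  -- Canonical forms with equal `Q` have T-parts with equal `Q`. Two lit parts are joined inside T;
  -- if exactly one part is zero, the other is singular and `merge` applies.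
  transitive-ext : Transitive T → Merging T g → Transitive (ext T g)
  transitive-ext transitive merge {x} {y} litx lity Qx≡Qy
    with canonical litx | canonical lity
  ... | f , r | f′ , r′ = r ◅◅ bridge (lit-or-zero f) (lit-or-zero f′) ◅◅ ~-sym r′
    where
    xor-cancelʳ : ∀ a b c → a xor c ≡ b xor c → a ≡ b
    xor-cancelʳ true  true  c     _  = refl
    xor-cancelʳ false false c     _  = refl
    xor-cancelʳ true  false true  ()
    xor-cancelʳ true  false false ()
    xor-cancelʳ false true  true  ()
    xor-cancelʳ false true  false ()

    Qf≡Qf′ : Q T f ≡ Q T f′
    Qf≡Qf′ = xor-cancelʳ _ _ (not (Q T g)) (begin
      Q T f xor not (Q T g)            ≡⟨ Q-canonical f ⟨
      Q (ext T g) (true ∷ false ∷ f)   ≡⟨ Q-invariant r ⟨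
      Q (ext T g) x                    ≡⟨ Qx≡Qy ⟩
      Q (ext T g) y                    ≡⟨ Q-invariant r′ ⟩
      Q (ext T g) (true ∷ false ∷ f′)  ≡⟨ Q-canonical f′ ⟩
      Q T f′ xor not (Q T g)           ∎)
      where open ≡-Reasoning

    bridge : Lit f ⊎ f ≡ zeros → Lit f′ ⊎ f′ ≡ zeros →
             ext T g ⊢ true ∷ false ∷ f ~ true ∷ false ∷ f′
    bridge (inj₁ l)    (inj₁ l′)   = lift-true (transitive l l′ Qf≡Qf′) false false
    bridge (inj₁ l)    (inj₂ refl) = ~-sym (merge l (trans Qf≡Qf′ (Q-zero T)))
    bridge (inj₂ refl) (inj₁ l′)   = merge l′ (trans (≡-sym Qf≡Qf′) (Q-zero T))
    bridge (inj₂ refl) (inj₂ refl) = ε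

-- Playing u from (1, 1, 0) and from (1, 1, z) gives (0, 1, g) and (0, 1, g ⊕ z),
-- which a witness z makes equivalent already by moves in T.
Witness : ∀ {n} → Shape n → Vec Bool n → Set
Witness T g = ∃ λ z → Lit z × Q T z ≡ false × β T z g ≡ false × Lit (g ⊕ z)

-- A single singular z suffices, since transitivity of T carries it to every singular f. The
-- conditions on z give g and g ⊕ z the same `Q`.
merging : ∀ {n} {T : Shape n} {g} → Lit g → Transitive T → Witness T g → Merging T g
merging {T = T} {g} litg transitive (z , litz , Qz , βzg , litgz) {f} litf Qf =
  adjust-u false true ◅◅ play-u ◅◅ middle ◅◅ ~-sym (play-u {f = z}) ◅◅
  lift-true (transitive litz litf (trans Qz (≡-sym Qf))) true false
  where
  Qg≡Qgz : Q T g ≡ Q T (g ⊕ z)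
  Qg≡Qgz rewrite Q-⊕ T g z | Qz | β-sym T g z | βzg = ≡-sym (xor-identityʳ (Q T g))

  -- Lifting leaves the state a of u open, but `Q` of (0, a, h) is Q h + a + β h g, and both g and g
  -- ⊕ z are orthogonal to g; invariance therefore fixes a.
  a≡true : ∀ a → Q (ext T g) (false ∷ true ∷ g) ≡ Q (ext T g) (false ∷ a ∷ g ⊕ z) →
           a ≡ true
  a≡true true  _  = refl
  a≡true false eq rewrite ≡-sym Qg≡Qgz | β-⊕ˡ T g z g | β-alt T g | βzg with Q T g
  a≡true false () | true
  a≡true false () | false

  middle : ext T g ⊢ false ∷ true ∷ g ⊕ zeros ~ false ∷ true ∷ g ⊕ z
  middle rewrite ⊕-identityʳ g with lift (transitive litg litgz Qg≡Qgz) false true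
  ... | a , r with a≡true a (Q-invariant r)
  ... | refl = r

-- With z = A x, extending x by zero to u′ and u gives the configuration (0, β T z g, z), so `Q` and
-- the pairings with old vertices persist. Pairing with `single w` reads off x at w, which is zero
-- at the new vertices, so there any witness of T serves; v supplies one.
witness-ext : ∀ {n} {T : Shape n} g → (∀ w → Witness T (single w)) →
              Fin n → ∀ w → Witness (ext T g) (single w)
witness-ext {T = T} g witness v = λ where
    zero          → at-new-vertex
    (suc zero)    → at-new-vertex
    (suc (suc w)) → let z , on t zt , Qz , βzw , on s ws = witness w in
      false ∷ β T z g ∷ z , on (suc (suc t)) zt , singular z Qz
      , trans (xor-identityʳ _) βzw , on (suc (suc s)) ws
  where
  singular : ∀ z → Q T z ≡ false → Q (ext T g) (false ∷ β T z g ∷ z) ≡ false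
  singular z Qz rewrite Qz | xor-same (β T z g) = refl

  orthogonal : ∀ b a z → β (ext T g) (false ∷ β T z g ∷ z) (b ∷ a ∷ zeros) ≡ false
  orthogonal b a z rewrite β-zeroʳ T z | xor-same (β T z g) = ∧-zeroʳ b

  at-new-vertex : ∀ {b a} → Witness (ext T g) (b ∷ a ∷ zeros)
  at-new-vertex {b} {a} = let z , on t zt , Qz , _ = witness v in
    false ∷ β T z g ∷ z , on (suc (suc t)) zt , singular z Qz , orthogonal b a z
    , on (suc (suc t)) (trans (cong (λ h → lookup h t) (⊕-identityˡ z)) zt)

-- Let x solve A x = `single w` over T. The configuration at w has support x, the one at u′ has x
-- together with u. This adds one vertex and evenly many edges, since x vanishes at w, the only
-- neighbour of u in T. So the two values of `Q` differ.
~-single : ∀ {n} {T : Shape n} w → Transitive (ext T (single w)) →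
           ∀ {f} → Lit f → ∃ λ t → ext T (single w) ⊢ f ~ single t
~-single {T = T} w transitive {f} lit = by-Q _ _ refl refl
  where
  Q-u′ : Q (ext T (single w)) (single zero) ≡ not (Q T (single w))
  Q-u′ rewrite Q-zero T | β-zeroˡ T (single w) = xor-identityʳ _

  Q-w : Q (ext T (single w)) (single (suc (suc w))) ≡ Q T (single w)
  Q-w rewrite β-alt T (single w) = xor-identityʳ _

  by-Q : ∀ x y → Q (ext T (single w)) f ≡ x → Q T (single w) ≡ y →
         ∃ λ t → ext T (single w) ⊢ f ~ single t
  by-Q x y Qf Qw with x ≟ᵇ y
  ... | yes x≡y = suc (suc w) ,
    transitive lit (on (suc (suc w)) (lookup-single w))
      (trans Qf (trans x≡y (≡-sym (trans Q-w Qw))))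
  ... | no x≢y = zero ,
    transitive lit (on zero refl)
      (trans Qf (trans (¬-not x≢y) (≡-sym (trans Q-u′ (cong not Qw)))))

-- The base tree E₆

edge : Shape 2
edge = ext nil []

path₄ : Shape 4
path₄ = ext edge (single (suc zero))

-- Vertex 3 of `path₄` is the u of `edge`; it becomes the centre, with legs of lengths 1, 2 and 2.
e₆ : Shape 6
e₆ = ext path₄ (single (suc (suc (suc zero))))

record Rich {n} (T : Shape n) : Set where
  field
    illuminate : Illuminable T
    transitive : Transitive T
    witness    : ∀ w → Witness T (single w)
    to-single  : ∀ {f} → Lit f → ∃ λ t → T ⊢ f ~ single t

attached-single : ∀ {n} (w : Fin n) {f : Vec Bool n} → Lit f → Lit (single w)
attached-single w _ = on w (lookup-single w)

rich-ext : ∀ {n} {T : Shape n} w → Rich T → Rich (ext T (single w))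
rich-ext {T = T} w rich = record
  { illuminate = illuminable-ext illuminate (attached-single w)
  ; transitive = transitive-T′
  ; witness    = witness-ext (single w) witness w
  ; to-single  = ~-single w transitive-T′
  }
  where
  open Rich rich

  transitive-T′ : Transitive (ext T (single w))
  transitive-T′ = transitive-ext illuminate (attached-single w) transitive
                    (merging (on w (lookup-single w)) transitive (witness w))

rich-e₆ : Rich e₆
rich-e₆ = record
  { illuminate = illuminable-ext illuminate₄ (attached-single centre)
  ; transitive = transitive₆
  ; witness    = witness₆
  ; to-single  = ~-single centre transitive₆
  }
  where
  centre : Fin 4
  centre = suc (suc (suc zero))

  none : {f : Vec Bool 0} {A : Set} → Lit f → A
  none (on () _)

  illuminate₂ : Illuminable edge
  illuminate₂ = illuminable-ext none none

  transitive₂ : Transitive edge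
  transitive₂ = transitive-ext {T = nil} none none none none

  illuminate₄ : Illuminable path₄
  illuminate₄ = illuminable-ext illuminate₂ (attached-single (suc zero))

  anisotropic : ∀ {f} → Lit f → Q edge f ≢ false
  anisotropic {true ∷ true ∷ []}   _ ()
  anisotropic {true ∷ false ∷ []}  _ ()
  anisotropic {false ∷ true ∷ []}  _ ()
  anisotropic {false ∷ false ∷ []} (on (suc (suc ())) _)

  transitive₄ : Transitive path₄
  transitive₄ = transitive-ext illuminate₂ (attached-single (suc zero)) transitive₂
    -- On `edge` the form is a + b + ab, which vanishes only at zero, so there is nothing to merge.
    (λ lit Qf → contradiction Qf (anisotropic lit))

  transitive₆ : Transitive e₆
  transitive₆ = transitive-ext illuminate₄ (attached-single centre) transitive₄
    (merging (on centre refl) transitive₄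
      -- This is A x for x supported on the nonadjacent vertices 1 and 2, whence `Q` is zero; x
      -- avoids the centre, whence `β` is zero.
      (single zero , on zero refl , refl , refl , on zero refl))

  witness₆ : ∀ w → Witness e₆ (single w)
  -- `z₁` and `z₂` are A x for x supported on {1, 3} and on {0, 5}. Each pair is nonadjacent, so `Q`
  -- vanishes; as the pairs are disjoint, every w is avoided by one of them, and that one is
  -- orthogonal to `single w`.
  witness₆ = λ where
      zero → z₁ , on zero refl , refl , refl , on (suc (suc zero)) refl
      (suc zero) → z₂ , lit₂ , refl , refl , on (suc zero) refl
      (suc (suc zero)) → z₂ , lit₂ , refl , refl , on (suc (suc zero)) refl
      (suc (suc (suc zero))) → z₂ , lit₂ , refl , refl , on (suc (suc (suc (suc zero)))) refl
      (suc (suc (suc (suc zero)))) → z₂ , lit₂ , refl , refl , on (suc (suc (suc zero))) refl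
      (suc (suc (suc (suc (suc zero))))) → z₁ , on zero refl , refl , refl , on zero refl
    where
    z₁ z₂ : Vec Bool 6
    z₁ = true ∷ false ∷ true ∷ false ∷ false ∷ false ∷ []
    z₂ = false ∷ false ∷ false ∷ true ∷ true ∷ false ∷ []

    lit₂ : Lit z₂
    lit₂ = on (suc (suc (suc zero))) refl

-- Growing a tree along its matching

bit : Bool → ℕ
bit b = if b then 1 else 0

countTrue-∷ : ∀ b bs → countTrue (b ∷ bs) ≡ bit b + countTrue bs
countTrue-∷ true  bs = refl
countTrue-∷ false bs = refl

countTrue-↭ : ∀ {bs bs′} → bs ↭ bs′ → countTrue bs ≡ countTrue bs′
countTrue-↭ Perm.refl = refl
countTrue-↭ (prep {bs} {bs′} b p)
  rewrite countTrue-∷ b bs | countTrue-∷ b bs′ = cong (bit b +_) (countTrue-↭ p)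
countTrue-↭ (swap true true p)   = cong (2 +_) (countTrue-↭ p)
countTrue-↭ (swap true false p)  = cong suc (countTrue-↭ p)
countTrue-↭ (swap false true p)  = cong suc (countTrue-↭ p)
countTrue-↭ (swap false false p) = countTrue-↭ p
countTrue-↭ (Perm.trans p q)     = trans (countTrue-↭ p) (countTrue-↭ q)

-- Pairs are taken by position instead of by `ltB`, so the count follows the growth of a list and,
-- for symmetric r, ignores its order.
edges : ∀ {A : Set} → (A → A → Bool) → List A → ℕ
edges r []      = 0
edges r (x ∷ L) = countTrue (map (r x) L) + edges r L

edges-↭ : ∀ {A : Set} {r : A → A → Bool} → (∀ x y → r x y ≡ r y x) →
          ∀ {L L′} → L ↭ L′ → edges r L ≡ edges r L′
edges-↭ r-sym Perm.refl        = refl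
edges-↭ {r = r} r-sym (prep x p) =
  cong₂ _+_ (countTrue-↭ (↭-map⁺ (r x) p)) (edges-↭ r-sym p)
edges-↭ r-sym (Perm.trans p q) = trans (edges-↭ r-sym p) (edges-↭ r-sym q)
edges-↭ {r = r} r-sym (swap {L} {L′} x y p)
  rewrite countTrue-∷ (r x y) (map (r x) L) | countTrue-∷ (r y x) (map (r y) L′)
        | r-sym y x | countTrue-↭ (↭-map⁺ (r x) p) | countTrue-↭ (↭-map⁺ (r y) p)
        | edges-↭ r-sym p =
  interchange +-commutativeSemigroup
    (bit (r x y)) (countTrue (map (r x) L′)) (countTrue (map (r y) L′))
    (edges r L′)

edges-map : ∀ {A B : Set} (r : B → B → Bool) (f : A → B) L →
            edges r (map f L) ≡ edges (λ x y → r (f x) (f y)) L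
edges-map r f []      = refl
edges-map r f (x ∷ L) =
  cong₂ _+_ (cong countTrue (≡-sym (map-∘ L))) (edges-map r f L)

edges-allFin : ∀ {n} (r : Fin n → Fin n → Bool) →
  sum (map (λ u → countTrue (map (λ v → if ltB u v then r u v else false) (allFin n))) (allFin n))
  ≡ edges r (allFin n)
edges-allFin {zero}  r = refl
edges-allFin {suc n} r = cong₂ _+_ (cong countTrue first-row) (begin
  sum (map row (List.tabulate suc))             ≡⟨ cong (sum ∘ map row) tabulate-suc ⟩
  sum (map row (map suc (allFin n)))            ≡⟨ cong sum (map-∘ (allFin n)) ⟨
  sum (map (row ∘ suc) (allFin n))              ≡⟨ cong sum (map-cong row-suc (allFin n)) ⟩
  _                                             ≡⟨ edges-allFin (λ u v → r (suc u) (suc v)) ⟩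
  edges (λ u v → r (suc u) (suc v)) (allFin n)  ≡⟨ edges-map r suc (allFin n) ⟨
  edges r (map suc (allFin n))                  ≡⟨ cong (edges r) tabulate-suc ⟨
  edges r (List.tabulate suc)                   ∎)
  where
  open ≡-Reasoning

  tabulate-suc : List.tabulate suc ≡ map suc (allFin n)
  tabulate-suc = ≡-sym (map-tabulate (λ i → i) suc)

  row : Fin (suc n) → ℕ
  row u = countTrue (map (λ v → if ltB u v then r u v else false) (allFin (suc n)))

  first-row : map (λ v → if ltB zero v then r zero v else false) (List.tabulate suc)
              ≡ map (r zero) (List.tabulate suc)
  first-row = trans (cong (map _) tabulate-suc) (trans (≡-sym (map-∘ (allFin n)))
    (trans (map-∘ (allFin n)) (cong (map (r zero)) (≡-sym tabulate-suc))))

  -- `ltB` never puts suc u below zero, so the first column disappears by computation.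
  row-suc : ∀ u → row (suc u) ≡
    countTrue (map (λ v → if ltB u v then r (suc u) (suc v) else false) (allFin n))
  row-suc u = cong countTrue (trans (cong (map _) tabulate-suc) (≡-sym (map-∘ (allFin n))))

module _ {A : Set} {p : A → Bool} where

  1≤countTrue : ∀ {L x} → x ∈ L → p x ≡ true → 1 ≤ countTrue (map p L)
  1≤countTrue (here refl) px rewrite px = s≤s z≤n
  1≤countTrue {y ∷ L} (there x∈L) px rewrite countTrue-∷ (p y) (map p L) =
    ≤-trans (1≤countTrue x∈L px) (m≤n+m _ (bit (p y)))

  2≤countTrue : ∀ {L x y} → x ∈ L → y ∈ L → p x ≡ true → p y ≡ true → x ≢ y →
                2 ≤ countTrue (map p L)
  2≤countTrue (here refl) (here refl) _ _ x≢y = contradiction refl x≢y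
  2≤countTrue (here refl) (there y∈L) px py _ rewrite px = s≤s (1≤countTrue y∈L py)
  2≤countTrue (there x∈L) (here refl) px py _ rewrite py = s≤s (1≤countTrue x∈L px)
  2≤countTrue {z ∷ L} (there x∈L) (there y∈L) px py x≢y rewrite countTrue-∷ (p z) (map p L) =
    ≤-trans (2≤countTrue x∈L y∈L px py x≢y) (m≤n+m _ (bit (p z)))

Full : ∀ {N} → List (Fin N) → Set
Full L = ∀ v → v ∈ L

full⇒↭ : ∀ {N} {L : List (Fin N)} → Unique L → Full L → L ↭ allFin N
full⇒↭ {N} unique full =
  ∼bag⇒↭ (unique∧set⇒bag unique (allFin⁺ N) (λ {v} → mk⇔ (λ _ → ∈-allFin v) (λ _ → full v)))

unique-∷ : ∀ {A : Set} {x : A} {L} → x ∉ L → Unique L → Unique (x ∷ L)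
unique-∷ x∉L unique = ¬Any⇒All¬ _ x∉L ∷ unique

lookup-injective : ∀ {A : Set} {L : List A} → Unique L → ∀ i j → L ‼ i ≡ L ‼ j → i ≡ j
lookup-injective (_ ∷ _)  zero    zero    _  = refl
lookup-injective (x∉ ∷ _) zero    (suc j) eq = contradiction eq (All.lookup x∉ (∈-lookup j))
lookup-injective (x∉ ∷ _) (suc i) zero    eq = contradiction (≡-sym eq) (All.lookup x∉ (∈-lookup i))
lookup-injective (_ ∷ u)  (suc i) (suc j) eq = cong suc (lookup-injective u i j eq)

unique-length≤ : ∀ {N} {L : List (Fin N)} → Unique L → length L ≤ N
unique-length≤ unique = injective⇒≤ (λ {i} {j} → lookup-injective unique i j)

module _ {N : ℕ} (Γ : Graph N) where

  data Attached : List (Fin N) → Set where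
    [-] : ∀ {x} → Attached (x ∷ [])
    _∷_ : ∀ {x L} → (∃ λ w → w ∈ L × adj Γ x w ≡ true) → Attached L → Attached (x ∷ L)

  data Tight : List (Fin N) → Set where
    []  : Tight []
    _∷_ : ∀ {x L} → (∀ {y z} → y ∈ L → z ∈ L → adj Γ x y ≡ true → adj Γ x z ≡ true → y ≡ z) →
          Tight L → Tight (x ∷ L)

  attached-bound : ∀ {L} → Attached L → length L ≤ suc (edges (adj Γ) L)
  attached-bound [-] = s≤s z≤n
  attached-bound ((w , w∈L , xw) ∷ attached) =
    s≤s (≤-trans (attached-bound attached) (+-monoˡ-≤ _ (1≤countTrue w∈L xw)))

  -- Every vertex but the last already contributes an edge into its tail. The bound allows no
  -- further edge, so no vertex has a second one.
  attached⇒tight : ∀ {L} → Attached L → edges (adj Γ) L < length L → Tight L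
  attached⇒tight [-] _ = (λ ()) ∷ []
  attached⇒tight {x ∷ L} ((w , w∈L , xw) ∷ attached) few =
    (λ {y} {z} y∈L z∈L xy xz → decidable-stable (y ≟ z) λ y≢z →
      <-irrefl refl (<-≤-trans
        (≤-<-trans (+-monoˡ-≤ (edges (adj Γ) L) (2≤countTrue y∈L z∈L xy xz y≢z)) few)
        (s≤s (attached-bound attached))))
    ∷ attached⇒tight attached
        (≤-trans (+-monoˡ-≤ (edges (adj Γ) L) (1≤countTrue w∈L xw)) (s≤s⁻¹ few))

  open import Data.List.Membership.DecPropositional (_≟_ {N}) using (_∈?_)

  crossing : ∀ {L x y} → Walk Γ x y → x ∈ L → y ∉ L →
             ∃₂ λ w u → w ∈ L × u ∉ L × adj Γ w u ≡ true
  crossing here x∈L y∉L = contradiction x∈L y∉L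
  crossing {L} {x} (step {w = w} xw walk) x∈L y∉L with w ∈? L
  ... | yes w∈L = crossing walk w∈L y∉L
  ... | no  w∉L = x , w , x∈L , w∉L , xw

  module _ (matching : PerfectMatching Γ) where
    open PerfectMatching matching

    Closed : List (Fin N) → Set
    Closed L = ∀ {v} → v ∈ L → partner v ∈ L

    -- u is consed before its partner: each new vertex then has a neighbour behind it, and L₀
    -- remains a suffix.
    data Grown (L₀ : List (Fin N)) : List (Fin N) → Set where
      start : Grown L₀ L₀
      add   : ∀ {L w u} → Grown L₀ L → w ∈ L → u ∉ L → adj Γ w u ≡ true →
              Grown L₀ (partner u ∷ u ∷ L)

    partner-≢ : ∀ v → partner v ≢ v
    partner-≢ v eq with trans (≡-sym (partner-adj v)) (trans (cong (adj Γ v) eq) (irrefl Γ v))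
    ... | ()

    partner-∉ : ∀ {L u} → Closed L → u ∉ L → partner u ∉ u ∷ L
    partner-∉ {u = u} closed u∉L (here eq) = partner-≢ u eq
    partner-∉ {L} {u} closed u∉L (there p∈L) = u∉L (subst (_∈ L) (partner-inv u) (closed p∈L))

    record Good (L : List (Fin N)) : Set where
      field
        closed   : Closed L
        unique   : Unique L
        attached : Attached L

    good-add : ∀ {L w u} → Good L → w ∈ L → u ∉ L → adj Γ w u ≡ true → Good (partner u ∷ u ∷ L)
    good-add {L} {w} {u} good w∈L u∉L wu = record
      { closed   = λ where
          (here refl)         → there (here (partner-inv u))
          (there (here refl)) → here refl
          (there (there v∈L)) → there (there (closed v∈L))
      ; unique   = unique-∷ (partner-∉ closed u∉L) (unique-∷ u∉L unique)
      ; attached = (u , here refl , trans (sym Γ (partner u) u) (partner-adj u))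
                 ∷ (w , w∈L , trans (sym Γ u w) wu) ∷ attached
      }
      where open Good good

    good-grown : ∀ {L₀ L} → Grown L₀ L → Good L₀ → Good L
    good-grown start                good = good
    good-grown (add grown w∈L u∉L wu) good = good-add (good-grown grown good) w∈L u∉L wu

    good-pair : ∀ v → Good (partner v ∷ v ∷ [])
    good-pair v = record
      { closed   = λ where
          (here refl)         → there (here (partner-inv v))
          (there (here refl)) → here refl
      ; unique   = unique-∷ (λ { (here eq) → partner-≢ v eq }) ([] ∷ [])
      ; attached = (v , here refl , trans (sym Γ (partner v) v) (partner-adj v)) ∷ [-]
      }

    nonempty : ∀ {L} → Attached L → ∃ λ x → x ∈ L
    nonempty [-]     = _ , here refl
    nonempty (_ ∷ _) = _ , here refl

    module _ (connected : Connected Γ) where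

      grow : ∀ {L₀} → Good L₀ → ∃ λ L → Grown L₀ L × Full L
      -- N rounds are ample, as each adds two vertices. With no fuel left, L has at least N distinct
      -- entries, so no vertex can be missing.
      grow {L₀} good₀ = loop N start (m≤n+m N (length L₀))
        where
        loop : ∀ k {L} → Grown L₀ L → N ≤ length L + k → ∃ λ L → Grown L₀ L × Full L
        loop k {L} grown bound with any? (λ v → ¬? (v ∈? L))
        ... | no  none = L , grown , λ v → decidable-stable (v ∈? L) λ v∉L → none (v , v∉L)
        ... | yes (v , v∉L) with good-grown grown good₀
        ... | good with nonempty (Good.attached good)
        ... | x , x∈L with crossing (connected x v) x∈L v∉L
        loop zero {L} grown bound | yes (v , v∉L) | good | _ | _ =
          contradiction (unique-length≤ (unique-∷ v∉L (Good.unique good)))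
            (<⇒≱ (s≤s (subst (N ≤_) (+-identityʳ (length L)) bound)))
        loop (suc k) {L} grown bound | yes _ | good | _ | w , u , w∈L , u∉L , wu =
          loop k (add grown w∈L u∉L wu)
            (≤-trans bound (subst (length L + suc k ≤_) (+-suc (suc (length L)) k) (m≤n+m _ 1)))

      tight-suffix : ∀ {L₀ L} → Grown L₀ L → Tight L → Tight L₀
      tight-suffix start             tight           = tight
      tight-suffix (add grown _ _ _) (_ ∷ _ ∷ tight) = tight-suffix grown tight

  full⇒tight : IsTree Γ → ∀ {L} → Attached L → L ↭ allFin N → Tight L
  full⇒tight tree attached p = attached⇒tight attached (few tree p)
    where
    -- Stated for arbitrary N because `IsTree` unfolds only after a split on the number of vertices.
    few : ∀ {N} {Γ : Graph N} → IsTree Γ → ∀ {L} → L ↭ allFin N → edges (adj Γ) L < length L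
    few {zero}  ()
    few {suc m} {Γ} (_ , count) p
      rewrite edges-↭ (sym Γ) p | ≡-sym (edges-allFin (adj Γ)) | count | ↭-length p
            | length-tabulate {n = suc m} (λ i → i) = ≤-refl

  tree⇒connected : IsTree Γ → Connected Γ
  tree⇒connected = connected-of
    where
    connected-of : ∀ {N} {Γ : Graph N} → IsTree Γ → Connected Γ
    connected-of {suc _} = proj₁

  module _ (tree : IsTree Γ) (matching : PerfectMatching Γ) where

    -- Every list grown from L is attached, so has at least length ∸ 1 edges; the full
    -- one has no more, which leaves one edge per vertex throughout.
    good⇒tight : ∀ {L} → Good matching L → Tight L
    good⇒tight good with grow matching (tree⇒connected tree) good
    ... | L′ , grown , full with good-grown matching grown good
    ... | good′ = tight-suffix matching (tree⇒connected tree) grown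
      (full⇒tight tree (Good.attached good′) (full⇒↭ (Good.unique good′) full))

-- Paths

read : ∀ {N} → Config N → (L : List (Fin N)) → Vec Bool (length L)
read c L = Vec.map c (fromList L)

toList-read : ∀ {N} (c : Config N) L → toList (read c L) ≡ map c L
toList-read c []      = refl
toList-read c (x ∷ L) = cong (c x ∷_) (toList-read c L)

lookup-read : ∀ {N} (c : Config N) L i → lookup (read c L) i ≡ c (L ‼ i)
lookup-read c (x ∷ L) zero    = refl
lookup-read c (x ∷ L) (suc i) = lookup-read c L i

numOn-read : ∀ {N} (c : Config N) {L f} → L ↭ allFin N → read c L ≡ f →
             numOn c ≡ countTrue (toList f)
numOn-read c {L} p refl =
  trans (countTrue-↭ (↭-map⁺ c (↭-sym p))) (cong countTrue (≡-sym (toList-read c L)))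

diff : ∀ {n} → Vec Bool (suc n) → Vec Bool n
diff (x ∷ [])     = []
diff (x ∷ y ∷ xs) = (x xor y) ∷ diff (y ∷ xs)

diff-surjective : ∀ {n} (f : Vec Bool n) x → ∃ λ xs → diff (x ∷ xs) ≡ f
diff-surjective []      x = [] , refl
diff-surjective (a ∷ f) x with diff-surjective f (x xor a)
... | xs , eq = (x xor a) ∷ xs ,
  cong₂ _∷_ (trans (≡-sym (xor-assoc x x a)) (cong (_xor a) (xor-same x))) eq

data Sorted : ∀ {n} → Vec Bool n → Set where
  trues   : ∀ {n} → Sorted (replicate n true)
  false∷_ : ∀ {n} {xs : Vec Bool n} → Sorted xs → Sorted (false ∷ xs)

diff-trues : ∀ n → countTrue (toList (diff (replicate (suc n) true))) ≡ 0
diff-trues zero    = refl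
diff-trues (suc n) = diff-trues n

diff-sorted : ∀ {n} {xs : Vec Bool (suc n)} → Sorted xs → countTrue (toList (diff xs)) ≤ 1
diff-sorted {n} trues = ≤-trans (≤-reflexive (diff-trues n)) z≤n
diff-sorted {zero} {false ∷ []} (false∷ _) = z≤n
diff-sorted {suc n} (false∷ trues) = s≤s (≤-reflexive (diff-trues n))
diff-sorted {suc n} (false∷ (false∷ sorted)) = diff-sorted (false∷ sorted)

module _ {N : ℕ} (Γ : Graph N) where

  Misses : Fin N → List (Fin N) → Set
  Misses v = All (λ y → adj Γ v y ≡ false)

  Hangs : Fin N → List (Fin N) → Set
  Hangs v []      = ⊤
  Hangs v (x ∷ P) = adj Γ v x ≡ true × Misses v P

  data Path : List (Fin N) → Set where
    []  : Path []
    _∷_ : ∀ {x P} → Hangs x P → Path P → Path (x ∷ P)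

  -- Reading a configuration on a path as the differences of a word, a move swaps
  -- two distinct adjacent letters.  The last two components say how the moves
  -- act on the vertices in front of P.
  Transforms : (P : List (Fin N)) → Vec Bool (suc (length P)) → Vec Bool (suc (length P)) → Set
  Transforms P xs ys = ∀ c → read c P ≡ diff xs → ∃ λ c′ →
    Reachable Γ c c′ × read c′ P ≡ diff ys ×
    (∀ {v} → Misses v P → c′ v ≡ c v) ×
    (∀ {v} → Hangs v P → c′ v xor head ys ≡ c v xor head xs)

  transforms-refl : ∀ {P xs} → Transforms P xs xs
  transforms-refl c eq = c , ε , eq , (λ _ → refl) , (λ _ → refl)

  transforms-trans : ∀ {P xs ys zs} → Transforms P xs ys → Transforms P ys zs → Transforms P xs zs
  transforms-trans f g c eq with f c eq
  ... | c₁ , r₁ , eq₁ , m₁ , h₁ with g c₁ eq₁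
  ... | c₂ , r₂ , eq₂ , m₂ , h₂ =
    c₂ , r₁ ◅◅ r₂ , eq₂ , (λ m → trans (m₂ m) (m₁ m)) , (λ h → trans (h₂ h) (h₁ h))

  -- The letter x stays fixed while the head behind it may change; p records the difference of the
  -- two and hangs on P, so it follows that head. Vertices hanging on p miss P and see no change.
  transforms-∷ : ∀ {p P xs ys} x → Hangs p P → Transforms P xs ys →
                 Transforms (p ∷ P) (x ∷ xs) (x ∷ ys)
  transforms-∷ {p} {P} {a ∷ xs} {b ∷ ys} x hangs f c eq with ∷-injective eq
  ... | cp , cP with f c cP
  ... | c′ , r , eq′ , misses′ , hangs′ =
    c′ , r , cong₂ _∷_ c′p eq′ , (λ { (_ ∷ m) → misses′ m })
    , λ { {v} (_ , m) → cong (_xor x) (misses′ m) }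
    where
    open ≡-Reasoning
    cancel : ∀ s t → (s xor t) xor t ≡ s
    cancel s t = trans (xor-assoc s t t) (trans (cong (s xor_) (xor-same t)) (xor-identityʳ s))
    c′p : c′ p ≡ x xor b
    c′p = begin
      c′ p                ≡⟨ cancel (c′ p) b ⟨
      (c′ p xor b) xor b  ≡⟨ cong (_xor b) (hangs′ hangs) ⟩
      (c p xor a) xor b   ≡⟨ cong (λ t → (t xor a) xor b) cp ⟩
      ((x xor a) xor a) xor b ≡⟨ cong (_xor b) (cancel x a) ⟩
      x xor b             ∎

  read-misses : ∀ {c p P} → Misses p P → read (toggleNbrs Γ p c) P ≡ read c P
  read-misses []       = refl
  read-misses {c} (m ∷ ms) =
    cong₂ _∷_ (trans (cong (c _ xor_) m) (xor-identityʳ _)) (read-misses ms)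

  -- The two letters differ, so p is on. Playing p leaves it on and flips the differences on either
  -- side, which is the effect of exchanging the letters.
  transforms-swap : ∀ {p P} xs → Hangs p P →
                    Transforms (p ∷ P) (true ∷ false ∷ xs) (false ∷ true ∷ xs)
  transforms-swap {p} {P} xs hangs c eq with ∷-injective eq
  ... | cp , cP = toggleNbrs Γ p c , move p cp ◅ ε , cong₂ _∷_ c′p (c′P P xs hangs cP)
    , (λ { {v} (m ∷ _) → trans (cong (c v xor_) (trans (sym Γ p v) m)) (xor-identityʳ (c v)) })
    , (λ { {v} (m , _) → trans (xor-identityʳ _) (cong (c v xor_) (trans (sym Γ p v) m)) })
    where
    c′p : toggleNbrs Γ p c p ≡ true
    c′p = cong₂ _xor_ cp (irrefl Γ p)
    c′P : ∀ P xs → Hangs p P → read c P ≡ diff (false ∷ xs) →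
          read (toggleNbrs Γ p c) P ≡ diff (true ∷ xs)
    c′P []      []       _         _  = refl
    c′P (q ∷ P) (y ∷ xs) (pq , ms) eq with ∷-injective eq
    ... | cq , rest =
      cong₂ _∷_ (trans (cong₂ _xor_ cq pq) (xor-comm y true)) (trans (read-misses ms) rest)

  bubble : ∀ {P} → Path P → ∀ {xs} → Sorted xs → ∃ λ ys → Sorted ys × Transforms P (true ∷ xs) ys
  bubble []             {[]} _       = _ , trues , transforms-refl
  bubble (hangs ∷ path) trues        = _ , trues , transforms-refl
  bubble (hangs ∷ path) (false∷ sorted) with bubble path sorted
  ... | ys , sorted′ , t =
    false ∷ ys , false∷ sorted′ ,
    transforms-trans (transforms-swap _ hangs) (transforms-∷ false hangs t)

  -- Insertion sort, with `bubble` inserting a leading `true`.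
  sort : ∀ {P} → Path P → ∀ xs → ∃ λ ys → Sorted ys × Transforms P xs ys
  sort []             (true ∷ [])  = _ , trues , transforms-refl
  sort []             (false ∷ []) = _ , false∷ trues , transforms-refl
  sort (hangs ∷ path) (x ∷ xs) with sort path xs
  sort (hangs ∷ path) (false ∷ xs) | ys , sorted , t = _ , false∷ sorted , transforms-∷ false hangs t
  sort (hangs ∷ path) (true ∷ xs)  | ys , sorted , t with bubble (hangs ∷ path) sorted
  ... | zs , sorted′ , t′ = zs , sorted′ , transforms-trans (transforms-∷ true hangs t) t′

  path⇒1-lit : ∀ {P} → Path P → P ↭ allFin N → KLit 1 Γ
  -- The first letter is free, because complementing a word keeps its differences.
  path⇒1-lit {P} path p c with diff-surjective (read c P) false
  ... | xs , eq with sort path (false ∷ xs)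
  ... | ys , sorted , t with t c (≡-sym eq)
  ... | c′ , r , eq′ , _ =
    c′ , r , subst (_≤ 1) (≡-sym (numOn-read c′ p eq′)) (diff-sorted sorted)

  Adjacent : Fin N → Fin N → Set
  Adjacent u v = adj Γ u v ≡ true

  adjacent-sym : ∀ {u v} → Adjacent u v → Adjacent v u
  adjacent-sym {u} {v} uv = trans (sym Γ v u) uv

  -- A pair can be joined on at either end of a linked list; at an inner vertex the two neighbours
  -- leave no room for it.
  data Position (w : Fin N) : List (Fin N) → Set where
    first : ∀ {P} → Position w (w ∷ P)
    last  : ∀ {P} Q → P ≡ Q ++ [ w ] → Position w P
    inner : ∀ {x y P} → x ∈ P → y ∈ P → x ≢ y → Adjacent w x → Adjacent w y → Position w P

  position : ∀ {P w} → Linked Adjacent P → Unique P → w ∈ P → Position w P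
  position _ _ (here refl) = first
  position {x ∷ _} (xy ∷ linked) ((x≢y ∷ x≢) ∷ unique) (there w∈P) with position linked unique w∈P
  ... | first {[]} = last [ x ] refl
  position {x ∷ _} (xy ∷ wz ∷ _) ((_ ∷ x≢z ∷ _) ∷ _) (there _) | first {z ∷ _} =
    inner (here refl) (there (there (here refl))) x≢z (adjacent-sym xy) wz
  position {x ∷ _} _ _ (there _) | last Q eq = last (x ∷ Q) (cong (x ∷_) eq)
  position {x ∷ _} _ _ (there _) | inner y∈ z∈ y≢z wy wz = inner (there y∈) (there z∈) y≢z wy wz

  linked-extend : ∀ P {w Q} → Linked Adjacent (P ++ [ w ]) → Linked Adjacent (w ∷ Q) →
                  Linked Adjacent (P ++ w ∷ Q)
  linked-extend []          _             linked = linked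
  linked-extend (x ∷ [])    (xw ∷ _)      linked = xw ∷ linked
  linked-extend (x ∷ y ∷ P) (xy ∷ linked) linked′ = xy ∷ linked-extend (y ∷ P) linked linked′

  linked⇒attached : ∀ {P x} → x ∈ P → Linked Adjacent P → Attached Γ P
  linked⇒attached _ [-]           = [-]
  linked⇒attached _ (xy ∷ linked) = (_ , here refl , xy) ∷ linked⇒attached (here refl) linked

  -- Tightness permits one neighbour further along, and the successor is one already, so there are
  -- no chords.
  linked⇒path : ∀ {P} → Linked Adjacent P → Unique P → Tight Γ P → Path P
  linked⇒path [] _ _ = []
  linked⇒path [-] _ _ = tt ∷ []
  linked⇒path (xy ∷ linked) (_ ∷ y∉ ∷ unique) (only ∷ tight) =
    (xy , All.tabulate λ z∈P → ¬-not λ xz → All.lookup y∉ z∈P (only (here refl) (there z∈P) xy xz))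
    ∷ linked⇒path linked (y∉ ∷ unique) tight

  module _ (matching : PerfectMatching Γ) where
    open PerfectMatching matching

    Branch : Fin N → Fin N → Fin N → Set
    Branch v a b = Adjacent v a × Adjacent v b × a ≢ b × a ≢ partner v × b ≢ partner v

    module _ (unbranched : ∀ v a b → ¬ Branch v a b) where

      -- At most one of x and y is the partner of w. The other would form a branch with u unless it
      -- equals u.
      two-neighbours : ∀ {w x y u} → Adjacent w x → Adjacent w y → x ≢ y →
                       Adjacent w u → u ≢ partner w → x ≡ u ⊎ y ≡ u
      two-neighbours {w} {x} {y} {u} wx wy x≢y wu u≢ with x ≟ u | y ≟ u
      ... | yes x≡u | _       = inj₁ x≡u
      ... | no _    | yes y≡u = inj₂ y≡u
      ... | no x≢u  | no y≢u with x ≟ partner w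
      ... | no x≢   = contradiction (wx , wu , x≢u , x≢ , u≢) (unbranched w x u)
      ... | yes x≡  = contradiction (wy , wu , y≢u , (λ y≡ → x≢y (trans x≡ (≡-sym y≡))) , u≢)
                        (unbranched w y u)

      order : ∀ {v L} → Grown Γ matching (partner v ∷ v ∷ []) L → ∃ λ P → Linked Adjacent P × P ↭ L
      order {v} start = _ , adjacent-sym (partner-adj v) ∷ [-] , ↭-refl
      order {v} (add {L} {w} {u} grown w∈L u∉L wu)
        with order grown | good-grown Γ matching grown (good-pair Γ matching v)
      ... | P , linked , P↭L | good
        with position linked (Unique-resp-↭ (setoid (Fin N)) (↭⇒↭ₛ (↭-sym P↭L)) (Good.unique good))
               (∈-resp-↭ (↭-sym P↭L) w∈L)
      ... | first = _ , adjacent-sym (partner-adj u) ∷ adjacent-sym wu ∷ linked , prep _ (prep _ P↭L)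
      ... | last P′ refl = _ , linked-extend P′ linked (wu ∷ partner-adj u ∷ [-]) ,
        ↭-trans (↭-reflexive (≡-sym (++-assoc P′ [ w ] (u ∷ partner u ∷ []))))
          (↭-trans (++-comm (P′ ++ [ w ]) _) (swap u (partner u) P↭L))
      -- L is closed under partners, so u is not the partner of w and must be one of the two
      -- neighbours already in L, which is absurd.
      ... | inner x∈ y∈ x≢y wx wy
        with two-neighbours wx wy x≢y wu
               (λ u≡ → u∉L (subst (_∈ L) (≡-sym u≡) (Good.closed good w∈L)))
      ... | inj₁ refl = contradiction (∈-resp-↭ P↭L x∈) u∉L
      ... | inj₂ refl = contradiction (∈-resp-↭ P↭L y∈) u∉L

-- Realising shapes in the tree

module _ {N : ℕ} (Γ : Graph N) where

  Models : (L : List (Fin N)) → Shape (length L) → Set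
  Models L T = ∀ s t → adj Γ (L ‼ s) (L ‼ t) ≡ lookup (nbr T s) t

  simulate : ∀ {L T} → Models L T → ∀ {f g} → T ⊢ f ~ g → ∀ c → read c L ≡ f →
             ∃ λ c′ → Reachable Γ c c′ × read c′ L ≡ g
  simulate models ε c eq = c , ε , eq
  simulate {L} {T} models (play s {f} fs ◅ r) c eq =
    let c′ , r′ , eq′ = simulate {L} {T} models r (toggleNbrs Γ (L ‼ s) c) (lookup-ext step-at)
    in c′ , move (L ‼ s) lit ◅ r′ , eq′
    where
    open ≡-Reasoning

    lit : c (L ‼ s) ≡ true
    lit = trans (≡-sym (lookup-read c L s)) (trans (cong (λ h → lookup h s) eq) fs)

    step-at : ∀ t → lookup (read (toggleNbrs Γ (L ‼ s) c) L) t ≡ lookup (nbr T s ⊕ f) t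
    step-at t = begin
      lookup (read (toggleNbrs Γ (L ‼ s) c) L) t  ≡⟨ lookup-read _ L t ⟩
      c (L ‼ t) xor adj Γ (L ‼ s) (L ‼ t)         ≡⟨ cong₂ _xor_ (≡-sym (lookup-read c L t)) (models s t) ⟩
      lookup (read c L) t xor lookup (nbr T s) t  ≡⟨ cong (λ h → lookup h t xor lookup (nbr T s) t) eq ⟩
      lookup f t xor lookup (nbr T s) t           ≡⟨ xor-comm (lookup f t) _ ⟩
      lookup (nbr T s) t xor lookup f t           ≡⟨ lookup-zipWith _xor_ t (nbr T s) f ⟨
      lookup (nbr T s ⊕ f) t                      ∎

  rich⇒1-lit : ∀ {L T} → Models L T → Rich T → L ↭ allFin N → KLit 1 Γ
  rich⇒1-lit {L} {T} models rich p c with lit-or-zero (read c L)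
  ... | inj₂ eq = c , ε ,
    ≤-trans (≤-reflexive (trans (numOn-read c p eq) (countTrue-zeros (length L)))) z≤n
  ... | inj₁ lit with Rich.to-single rich lit
  ... | t , r with simulate {L} {T} models r c refl
  ... | c′ , r′ , eq = c′ , r′ ,
    ≤-reflexive (trans (numOn-read c′ p eq) (countTrue-single t))

  models-pair : ∀ {u′ u} → Adjacent Γ u′ u → Models (u′ ∷ u ∷ []) edge
  models-pair {u′} {u} u′u zero       zero       = irrefl Γ u′
  models-pair {u′} {u} u′u zero       (suc zero) = u′u
  models-pair {u′} {u} u′u (suc zero) zero       = adjacent-sym Γ u′u
  models-pair {u′} {u} u′u (suc zero) (suc zero) = irrefl Γ u

  -- Tightness supplies the nonedges: u′ has no neighbour behind it but u, and u none but `L ‼ i`.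
  models-ext : ∀ {u′ u L T} i → Models L T → Unique (u′ ∷ u ∷ L) → Tight Γ (u′ ∷ u ∷ L) →
               Adjacent Γ u′ u → Adjacent Γ u (L ‼ i) → Models (u′ ∷ u ∷ L) (ext T (single i))
  models-ext {u′} {u} {L} {T} i models (_ ∷ u∉L ∷ unique) (only-u ∷ only-w ∷ _) u′u uw = λ where
      zero          zero          → irrefl Γ u′
      zero          (suc zero)    → u′u
      zero          (suc (suc t)) → trans (u′-misses t) (≡-sym (lookup-replicate t false))
      (suc zero)    zero          → adjacent-sym Γ u′u
      (suc zero)    (suc zero)    → irrefl Γ u
      (suc zero)    (suc (suc t)) → u-meets t
      (suc (suc s)) zero          → trans (sym Γ _ u′) (u′-misses s)
      (suc (suc s)) (suc zero)    → trans (sym Γ _ u) (u-meets s)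
      (suc (suc s)) (suc (suc t)) → models s t
    where
    u′-misses : ∀ t → adj Γ u′ (L ‼ t) ≡ false
    u′-misses t = ¬-not λ u′t →
      All.lookup u∉L (∈-lookup t) (only-u (here refl) (there (∈-lookup t)) u′u u′t)

    u-meets : ∀ t → adj Γ u (L ‼ t) ≡ lookup (single i) t
    u-meets t with t ≟ i
    ... | yes refl = trans uw (≡-sym (lookup-single i))
    ... | no t≢i = trans
      (¬-not λ ut → t≢i (lookup-injective unique t i (only-w (∈-lookup t) (∈-lookup i) ut uw)))
      (≡-sym (lookup-single-≢ t≢i))

  module _ (tree : IsTree Γ) (matching : PerfectMatching Γ) where
    open PerfectMatching matching

    good-models-ext : ∀ {u L T} i → Good Γ matching L → Models L T → u ∉ L → Adjacent Γ (L ‼ i) u →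
                      Models (partner u ∷ u ∷ L) (ext T (single i))
    good-models-ext {u} {L} i good models u∉L iu =
      models-ext i models (Good.unique good′) (good⇒tight Γ tree matching good′)
        (adjacent-sym Γ (partner-adj u)) (adjacent-sym Γ iu)
      where
      good′ : Good Γ matching (partner u ∷ u ∷ L)
      good′ = good-add Γ matching good (∈-lookup i) u∉L iu

    RichModel : List (Fin N) → Set
    RichModel L = ∃ λ T → Models L T × Rich T

    rich-grown : ∀ {L₀ L} → Grown Γ matching L₀ L → Good Γ matching L₀ → RichModel L₀ → RichModel L
    rich-grown start _ rich = rich
    rich-grown (add {L} {w} {u} grown w∈L u∉L wu) good rich with rich-grown grown good rich
    ... | T , models , richT = ext T (single i) ,
      good-models-ext i (good-grown Γ matching grown good) models u∉L
        (subst (λ v → Adjacent Γ v u) (lookup-index w∈L) wu) , rich-ext i richT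
      where
      i : Fin (length L)
      i = index w∈L

    branched⇒1-lit : ∀ {v a b} → Branch Γ matching v a b → KLit 1 Γ
    branched⇒1-lit {v} {a} {b} (va , vb , a≢b , a≢v′ , b≢v′) =
      let L , grown , full = grow Γ matching (tree⇒connected Γ tree) good₆
          T , models , rich = rich-grown grown good₆ (e₆ , models₆ , rich-e₆)
      in rich⇒1-lit models rich (full⇒↭ (Good.unique (good-grown Γ matching grown good₆)) full)
      where
      L₂ L₄ : List (Fin N)
      L₂ = partner v ∷ v ∷ []
      L₄ = partner a ∷ a ∷ L₂

      ≢-centre : ∀ {u} → Adjacent Γ v u → u ≢ v
      ≢-centre vu refl with trans (≡-sym vu) (irrefl Γ v)
      ... | ()

      ∉-L₂ : ∀ {u} → Adjacent Γ v u → u ≢ partner v → u ∉ L₂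
      ∉-L₂ vu u≢v′ (here u≡v′)        = u≢v′ u≡v′
      ∉-L₂ vu u≢v′ (there (here u≡v)) = ≢-centre vu u≡v

      a∉L₂ : a ∉ L₂
      a∉L₂ = ∉-L₂ va a≢v′

      good₂ : Good Γ matching L₂
      good₂ = good-pair Γ matching v

      good₄ : Good Γ matching L₄
      good₄ = good-add Γ matching good₂ (there (here refl)) a∉L₂ va

      b∉L₄ : b ∉ L₄
      -- If b were the partner of a, then v, a and b would form a triangle.
      b∉L₄ (here refl) with good⇒tight Γ tree matching good₄
      ... | only ∷ _ = ≢-centre va (only (here refl) (there (there (here refl)))
                         (adjacent-sym Γ (partner-adj a)) (adjacent-sym Γ vb))
      b∉L₄ (there (here b≡a))   = a≢b (≡-sym b≡a)
      b∉L₄ (there (there b∈L₂)) = ∉-L₂ vb b≢v′ b∈L₂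

      -- The centre v has index 1 in `L₂` and index 3 in `L₄`.
      models₆ : Models (partner b ∷ b ∷ L₄) e₆
      models₆ = good-models-ext (suc (suc (suc zero))) good₄
        (good-models-ext (suc zero) good₂ (models-pair (adjacent-sym Γ (partner-adj v))) a∉L₂ va)
        b∉L₄ vb

      good₆ : Good Γ matching (partner b ∷ b ∷ L₄)
      good₆ = good-add Γ matching good₄ (there (there (there (here refl)))) b∉L₄ vb

    unbranched⇒1-lit : (∀ v a b → ¬ Branch Γ matching v a b) → Fin N → KLit 1 Γ
    unbranched⇒1-lit unbranched v =
      let L , grown , full = grow Γ matching (tree⇒connected Γ tree) (good-pair Γ matching v)
          good = good-grown Γ matching grown (good-pair Γ matching v)
          P , linked , P↭L = order Γ matching unbranched grown
          L↭ = full⇒↭ (Good.unique good) full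
          P↭ = ↭-trans P↭L L↭
          -- The reordered list need not be `Grown`, but being linked it is attached, and it
          -- contains all vertices.
          tight = full⇒tight Γ tree (linked⇒attached Γ (∈-resp-↭ (↭-sym P↭L) (full v)) linked) P↭
      in path⇒1-lit Γ (linked⇒path Γ linked
           (Unique-resp-↭ (setoid (Fin N)) (↭⇒↭ₛ (↭-sym P↭L)) (Good.unique good)) tight) P↭

theorem1p1 : ∀ {n : ℕ} (Γ : Graph n) → IsTree Γ → PerfectMatching Γ → KLit 1 Γ
theorem1p1 {zero} Γ ()
theorem1p1 {suc m} Γ tree matching with any? (λ v → any? λ a → any? λ b →
    (adj Γ v a ≟ᵇ true) ×-dec (adj Γ v b ≟ᵇ true) ×-dec
    ¬? (a ≟ b) ×-dec ¬? (a ≟ partner v) ×-dec ¬? (b ≟ partner v))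
  where open PerfectMatching matching
... | yes (v , a , b , branch) = branched⇒1-lit Γ tree matching branch
... | no unbranched =
  unbranched⇒1-lit Γ tree matching (λ v a b branch → unbranched (v , a , b , branch)) zero
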